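{- Consider materializing the permutation $$\pi_m(a\mathbin{+\!\!+}c)=\pi_{m_2}(c)\mathbin{+\!\!+}\pi_{m_1}(a),\qquad a\in[N_1],\ c\in[N_2],$$ between the source ownership $\operatorname{owner}_0(a,c)=\lfloor cp/N_2\rfloor$ and the target ownership $\operatorname{owner}_1(u,v)=\lfloor vp/N_1\rfloor$. Any such algorithm must communicate at least $$\mu\ge N\left(1-\frac1p\right)$$ remote items. Moreover, $$\max_{q\in[p]}\left\{h_q^{\mathrm{send}},h_q^{\mathrm{recv}}\right\}\ge\frac Np\left(1-\frac1p\right).$$
   Context: $b=2^t$ is a fixed radix, $N=N_1N_2$, $N_1=b^{m_1}$, $N_2=b^{m_2}$, $m=m_1+m_2$; there are $p\ge2$ processors indexed by $[p]=\{0,\dots,p-1\}$, $p$ is a power of $b$, and $p\mid N_1$, $p\mid N_2$. $\pi_\ell:[b^\ell]\to[b^\ell]$ is base-$b$ digit reversal, and $\mathbin{+\!\!+}$ is concatenation of base-$b$ digit fields (left operand more significant). Materializing the permutation means: each of the $N$ items, initially stored (without replication) at source coordinate $(a,c)$ of an $N_1\times N_2$ array on processor $\operatorname{owner}_0(a,c)$, must end at target coordinate $(u,v)=(\pi_{m_2}(c),\pi_{m_1}(a))$ of an $N_2\times N_1$ array on processor $\operatorname{owner}_1(u,v)$. Items are atomic: an item whose source and target processors differ must cross a processor boundary at least once. $\mu$ is the aggregate number of remotely transmitted items; $h_q^{\mathrm{send}}$ and $h_q^{\mathrm{recv}}$ are the numbers of remote items sent and received by processor $q$. -}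

module Defs where

open import Data.Nat as ℕ using (ℕ; zero; suc; _+_; _*_; _^_; _∸_; _⊔_; NonZero)
open import Data.Nat.DivMod using (_/_; m<n*o⇒m/o<n)
import Data.Nat.Properties as ℕₚ
open import Data.Fin as Fin
  using (Fin; zero; suc; toℕ; fromℕ<; cast; combine; opposite; splitAt;
         _↑ˡ_; _↑ʳ_; finToFun; funToFin; _≟_)
open import Data.Fin.Properties as Finₚ using ()
open import Data.Fin.Subset using (Subset; ⁅_⁆; _∈_)
open import Data.List as List using (List; []; length; filter; map; allFin)
open import Data.List.Extrema.Nat using (max)
open import Data.List.Relation.Unary.All using (All)
open import Data.List.Relation.Unary.Any using (Any)
open import Data.Product using (_×_; _,_)
open import Data.Sum using (_⊎_; inj₁; inj₂; [_,_]′)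
open import Function using (_∘_)
open import Relation.Binary.Construct.Closure.ReflexiveTransitive
  using (Star; ε; _◅_)
open import Relation.Binary.PropositionalEquality
open import Relation.Nullary using (Dec; ¬?)

module DigitReversal (b : ℕ) where

  -- finToFun reads off the base-b digits of a number, most significant first.
  π : ∀ ℓ → Fin (b ^ ℓ) → Fin (b ^ ℓ)
  π ℓ x = funToFin {ℓ} {b} (finToFun {b} {ℓ} x ∘ opposite)

  infixr 5 _++_

  _++_ : ∀ {k ℓ} → Fin (b ^ k) → Fin (b ^ ℓ) → Fin (b ^ (k + ℓ))
  _++_ {k} {ℓ} x y = cast (sym (ℕₚ.^-distribˡ-+-* b k ℓ)) (combine x y)

  private
    funToFin-cong : ∀ {n} {f g : Fin n → Fin b} → f ≗ g → funToFin f ≡ funToFin g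
    funToFin-cong {zero}  f≗g = refl
    funToFin-cong {suc n} f≗g =
      cong₂ combine (f≗g zero) (funToFin-cong (f≗g ∘ suc))

    funToFin-cast : ∀ {k n} (eq : k ≡ n) {f : Fin k → Fin b} {g : Fin n → Fin b} →
      (∀ i → f i ≡ g (cast eq i)) →
      cast (cong (b ^_) eq) (funToFin f) ≡ funToFin g
    funToFin-cast refl {g = g} f≗g = trans (Finₚ.cast-is-id refl _)
      (funToFin-cong λ i → trans (f≗g i) (cong g (Finₚ.cast-is-id refl i)))

    glue : ∀ {k n} → (Fin k → Fin b) → (Fin n → Fin b) → Fin (k + n) → Fin b
    glue {k} f g i = [ f , g ]′ (splitAt k i)

    toℕ-++ : ∀ k n (x : Fin (b ^ k)) (y : Fin (b ^ n)) →
      toℕ (_++_ {k} {n} x y) ≡ b ^ n * toℕ x + toℕ y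
    toℕ-++ k n x y = trans (Finₚ.toℕ-cast _ (combine x y)) (Finₚ.toℕ-combine x y)

    funToFin-glue : ∀ k {n} (f : Fin k → Fin b) (g : Fin n → Fin b) →
      funToFin (glue f g) ≡ _++_ {k} {n} (funToFin f) (funToFin g)
    funToFin-glue zero {n} f g = Finₚ.toℕ-injective (sym (begin
      toℕ (_++_ {0} {n} zero (funToFin g)) ≡⟨ toℕ-++ 0 n zero (funToFin g) ⟩
      b ^ n * 0 + toℕ (funToFin g)         ≡⟨ cong (_+ toℕ (funToFin g)) (ℕₚ.*-zeroʳ (b ^ n)) ⟩
      toℕ (funToFin g)                     ∎))
      where open ≡-Reasoning
    funToFin-glue (suc k) {n} f g = Finₚ.toℕ-injective (begin
      toℕ (combine (f zero) (funToFin (glue f g ∘ suc)))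
        ≡⟨ cong (λ u → toℕ (combine {b} {b ^ (k + n)} (f zero) u)) (trans (funToFin-cong step) (funToFin-glue k (f ∘ suc) g)) ⟩
      toℕ (combine (f zero) (_++_ {k} {n} F G))
        ≡⟨ Finₚ.toℕ-combine (f zero) (_++_ {k} {n} F G) ⟩
      b ^ (k + n) * d + toℕ (_++_ {k} {n} F G)
        ≡⟨ cong₂ (λ u v → u * d + v) (ℕₚ.^-distribˡ-+-* b k n) (toℕ-++ k n F G) ⟩
      b ^ k * b ^ n * d + (b ^ n * toℕ F + toℕ G)
        ≡⟨ ℕₚ.+-assoc (b ^ k * b ^ n * d) _ _ ⟨
      b ^ k * b ^ n * d + b ^ n * toℕ F + toℕ G
        ≡⟨ cong (λ u → u * d + b ^ n * toℕ F + toℕ G) (ℕₚ.*-comm (b ^ k) (b ^ n)) ⟩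
      b ^ n * b ^ k * d + b ^ n * toℕ F + toℕ G
        ≡⟨ cong (λ u → u + b ^ n * toℕ F + toℕ G) (ℕₚ.*-assoc (b ^ n) (b ^ k) d) ⟩
      b ^ n * (b ^ k * d) + b ^ n * toℕ F + toℕ G
        ≡⟨ cong (_+ toℕ G) (ℕₚ.*-distribˡ-+ (b ^ n) (b ^ k * d) (toℕ F)) ⟨
      b ^ n * (b ^ k * d + toℕ F) + toℕ G
        ≡⟨ cong (λ u → b ^ n * u + toℕ G) (Finₚ.toℕ-combine (f zero) F) ⟨
      b ^ n * toℕ (funToFin f) + toℕ G
        ≡⟨ toℕ-++ (suc k) n (funToFin f) G ⟨
      toℕ (_++_ {suc k} {n} (funToFin f) G) ∎)
      where
      open ≡-Reasoning
      d = toℕ (f zero)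
      F = funToFin (f ∘ suc)
      G = funToFin g
      step : glue f g ∘ suc ≗ glue (f ∘ suc) g
      step i with splitAt k i
      ... | inj₁ _ = refl
      ... | inj₂ _ = refl

    finToFun-++ : ∀ k n (x : Fin (b ^ k)) (y : Fin (b ^ n)) →
      finToFun {b} {k + n} (_++_ {k} {n} x y) ≗ glue (finToFun {b} {k} x) (finToFun {b} {n} y)
    finToFun-++ k n x y i = begin
      finToFun {b} {k + n} (_++_ {k} {n} x y) i
        ≡⟨ cong₂ (λ u v → finToFun {b} {k + n} (_++_ {k} {n} u v) i)
             (Finₚ.funToFin-finToFin {k} {b} x) (Finₚ.funToFin-finToFin {n} {b} y) ⟨
      finToFun {b} {k + n} (_++_ {k} {n} (funToFin fx) (funToFin fy)) i
        ≡⟨ cong (λ u → finToFun {b} {k + n} u i) (funToFin-glue k fx fy) ⟨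
      finToFun (funToFin (glue fx fy)) i
        ≡⟨ Finₚ.finToFun-funToFin (glue fx fy) i ⟩
      glue fx fy i ∎
      where
      open ≡-Reasoning
      fx = finToFun {b} {k} x
      fy = finToFun {b} {n} y

    glue-opposite : ∀ k n (f : Fin k → Fin b) (g : Fin n → Fin b) i →
      glue f g (opposite i) ≡ glue (g ∘ opposite) (f ∘ opposite) (cast (ℕₚ.+-comm k n) i)
    glue-opposite k n f g i with splitAt n (cast (ℕₚ.+-comm k n) i) in eq
    ... | inj₁ j = cong [ f , g ]′ (trans (cong (splitAt k) flip) (Finₚ.splitAt-↑ʳ k n (opposite j)))
      where
      open ≡-Reasoning
      i≡j : toℕ i ≡ toℕ j
      i≡j = begin
        toℕ i                          ≡⟨ Finₚ.toℕ-cast (ℕₚ.+-comm k n) i ⟨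
        toℕ (cast (ℕₚ.+-comm k n) i)   ≡⟨ cong toℕ (Finₚ.splitAt⁻¹-↑ˡ eq) ⟨
        toℕ (j ↑ˡ k)                   ≡⟨ Finₚ.toℕ-↑ˡ j k ⟩
        toℕ j                          ∎
      flip : opposite i ≡ k ↑ʳ opposite j
      flip = Finₚ.toℕ-injective (begin
        toℕ (opposite i)         ≡⟨ Finₚ.opposite-prop i ⟩
        k + n ∸ suc (toℕ i)      ≡⟨ cong (λ u → k + n ∸ suc u) i≡j ⟩
        k + n ∸ suc (toℕ j)      ≡⟨ ℕₚ.+-∸-assoc k (Finₚ.toℕ<n j) ⟩
        k + (n ∸ suc (toℕ j))    ≡⟨ cong (k +_) (Finₚ.opposite-prop j) ⟨
        k + toℕ (opposite j)     ≡⟨ Finₚ.toℕ-↑ʳ k (opposite j) ⟨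
        toℕ (k ↑ʳ opposite j)    ∎)
    ... | inj₂ j = cong [ f , g ]′ (trans (cong (splitAt k) flip) (Finₚ.splitAt-↑ˡ k (opposite j) n))
      where
      open ≡-Reasoning
      i≡n+j : toℕ i ≡ n + toℕ j
      i≡n+j = begin
        toℕ i                          ≡⟨ Finₚ.toℕ-cast (ℕₚ.+-comm k n) i ⟨
        toℕ (cast (ℕₚ.+-comm k n) i)   ≡⟨ cong toℕ (Finₚ.splitAt⁻¹-↑ʳ {m = n} eq) ⟨
        toℕ (n ↑ʳ j)                   ≡⟨ Finₚ.toℕ-↑ʳ n j ⟩
        n + toℕ j                      ∎
      flip : opposite i ≡ opposite j ↑ˡ n
      flip = Finₚ.toℕ-injective (begin
        toℕ (opposite i)              ≡⟨ Finₚ.opposite-prop i ⟩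
        k + n ∸ suc (toℕ i)           ≡⟨ cong (λ u → k + n ∸ suc u) i≡n+j ⟩
        k + n ∸ suc (n + toℕ j)       ≡⟨ cong₂ _∸_ (ℕₚ.+-comm k n) (sym (ℕₚ.+-suc n (toℕ j))) ⟩
        n + k ∸ (n + suc (toℕ j))     ≡⟨ ℕₚ.[m+n]∸[m+o]≡n∸o n k (suc (toℕ j)) ⟩
        k ∸ suc (toℕ j)               ≡⟨ Finₚ.opposite-prop j ⟨
        toℕ (opposite j)              ≡⟨ Finₚ.toℕ-↑ˡ (opposite j) n ⟨
        toℕ (opposite j ↑ˡ n)         ∎)

  π-++ : ∀ k ℓ (a : Fin (b ^ k)) (c : Fin (b ^ ℓ)) →
    cast (cong (b ^_) (ℕₚ.+-comm k ℓ)) (π (k + ℓ) (_++_ {k} {ℓ} a c))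
      ≡ _++_ {ℓ} {k} (π ℓ c) (π k a)
  π-++ k ℓ a c = trans
    (funToFin-cast (ℕₚ.+-comm k ℓ) λ i →
      trans (finToFun-++ k ℓ a c (opposite i))
            (glue-opposite k ℓ (finToFun {b} {k} a) (finToFun {b} {ℓ} c) i))
    (funToFin-glue ℓ (finToFun {b} {ℓ} c ∘ opposite) (finToFun {b} {k} a ∘ opposite))

blockOwner : ∀ {n} p .{{_ : NonZero p}} → Fin n → Fin p
blockOwner {n} p i = fromℕ< (m<n*o⇒m/o<n {toℕ i * p} {p} {n} bound)
  where
  instance _ = Finₚ.nonZeroIndex i
  bound : toℕ i * p ℕ.< p * n
  bound = subst (toℕ i * p ℕ.<_) (ℕₚ.*-comm n p) (ℕₚ.*-monoˡ-< p (Finₚ.toℕ<n i))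

toℕ-blockOwner : ∀ {n} p .{{_ : NonZero p}} .{{_ : NonZero n}} (i : Fin n) →
  toℕ (blockOwner p i) ≡ toℕ i * p / n
toℕ-blockOwner p i = Finₚ.toℕ-fromℕ< _

module Redistribution (b m₁ m₂ p : ℕ) .{{_ : NonZero p}} where

  open DigitReversal b public

  N₁ N₂ N : ℕ
  N₁ = b ^ m₁
  N₂ = b ^ m₂
  N  = N₁ * N₂

  -- An item is named by its source coordinate (a , c).
  Item : Set
  Item = Fin N₁ × Fin N₂

  -- By π-++, the item at index a ++ c is sent to index u ++ v = π (m₁ + m₂) (a ++ c).
  target : Item → Fin N₂ × Fin N₁
  target (a , c) = π m₂ c , π m₁ a

  owner₀ : Fin N₁ × Fin N₂ → Fin p
  owner₀ (a , c) = blockOwner p c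

  owner₁ : Fin N₂ × Fin N₁ → Fin p
  owner₁ (u , v) = blockOwner p v

  -- The set of processors currently holding a copy of each item.
  Storage : Set
  Storage = Item → Subset p

  initial : Storage
  initial x = ⁅ owner₀ x ⁆

  Materialized : Storage → Set
  Materialized S = ∀ x → owner₁ (target x) ∈ S x

  record Transmission : Set where
    field
      item     : Item
      sender   : Fin p
      receiver : Fin p

  open Transmission public

  Delivers : Item → Fin p → Transmission → Set
  Delivers x q τ = item τ ≡ x × receiver τ ≡ q

  -- All transmissions of a superstep are concurrent. Local copies may be kept
  -- or dropped, but an item can only appear on a processor by being received.
  record Superstep (S S′ : Storage) : Set where
    field
      traffic : List Transmission
      held    : All (λ τ → sender τ ∈ S (item τ)) traffic
      origin  : ∀ {x q} → q ∈ S′ x → q ∈ S x ⊎ Any (Delivers x q) traffic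

  open Superstep public

  Execution : Storage → Storage → Set
  Execution = Star Superstep

  Remote : Transmission → Set
  Remote τ = sender τ ≢ receiver τ

  remote? : ∀ τ → Dec (Remote τ)
  remote? τ = ¬? (sender τ ≟ receiver τ)

  remoteTraffic : ∀ {S S′} → Execution S S′ → List Transmission
  remoteTraffic ε           = []
  remoteTraffic (step ◅ e) = filter remote? (traffic step) List.++ remoteTraffic e

  μ : ∀ {S S′} → Execution S S′ → ℕ
  μ e = length (remoteTraffic e)

  hˢᵉⁿᵈ hʳᵉᶜᵛ : ∀ {S S′} → Execution S S′ → Fin p → ℕ
  hˢᵉⁿᵈ e q = length (filter (λ τ → sender τ ≟ q) (remoteTraffic e))
  hʳᵉᶜᵛ e q = length (filter (λ τ → receiver τ ≟ q) (remoteTraffic e))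

  -- The first argument of max is only a default value for the empty list.
  maxLoad : ∀ {S S′} → Execution S S′ → ℕ
  maxLoad e = max 0 (map (λ q → hˢᵉⁿᵈ e q ⊔ hʳᵉᶜᵛ e q) (allFin p))

{-# OPTIONS --safe #-}
module Submission where

-- An item can reach a processor other than its source owner only inside a
-- remote transmission received by that processor: following a copy backwards,
-- each local "transmission" leads to an earlier copy on the same processor
-- (arrival).  So an execution that materializes the permutation has, for each
-- displaced item, a remote transmission of that item to its target owner.
--
-- Write p = suc p′, N₁ = p K₁ and N₂ = p K₂.  Each owner map cuts its axis into
-- p blocks of consecutive coordinates (blockOwner-block), the source owner
-- depends only on c, and the target owner only on the image of a under the
-- bijection π.  Hence for each pair q ≠ r exactly K₁ K₂ items move from
-- processor r to processor q.  Each q thus receives at least p′ K₁ K₂ remote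
-- items, which is (N / p) (1 - 1 / p) (recv-bound); over all q this gives at
-- least p p′ K₁ K₂ = N (1 - 1 / p) transmissions (volume-bound).

open import Defs
open import Data.Nat using (ℕ; zero; suc; _^_; NonZero) renaming (_≤_ to _≤ℕ_)
import Data.Nat as ℕ
import Data.Nat.DivMod as ℕ
import Data.Nat.Properties as ℕₚ
import Data.Nat.Tactic.RingSolver as ℕSolver
open import Data.Nat.Divisibility using (_∣_; divides; m∣m*n)
open import Data.Integer using (+_)
import Data.Integer as ℤ
import Data.Integer.Properties as ℤₚ
import Data.Integer.Tactic.RingSolver as ℤSolver
open import Data.Rational using (1ℚ; _/_; _*_; _-_; -_; _≥_; toℚᵘ)
import Data.Rational.Properties as ℚₚ
open import Data.Rational.Unnormalised as ℚᵘ using (mkℚᵘ; 1ℚᵘ; *≤*)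
import Data.Rational.Unnormalised.Properties as ℚᵘₚ
open import Data.Fin using (Fin; zero; toℕ; cast; combine; opposite; punchIn;
  funToFin; finToFun; _≟_)
import Data.Fin.Properties as Finₚ
open import Data.Fin.Subset using (_∈_)
open import Data.Fin.Subset.Properties using (x∈⁅y⁆⇒x≡y)
open import Data.List using (List; length; lookup; allFin)
open import Data.List.Extrema.Nat using (xs≤max)
import Data.List.Relation.Unary.All as All
import Data.List.Relation.Unary.All.Properties as Allₚ
open import Data.List.Relation.Unary.Any as Any using (Any; index)
import Data.List.Relation.Unary.Any.Properties as Anyₚ
open import Data.List.Membership.Propositional using (find; lose)
open import Data.List.Membership.Propositional.Properties
  using (∈-filter⁺; ∈-allFin)
open import Data.Product using (_×_; _,_; ∃-syntax; proj₁)
open import Data.Product.Properties using (,-injectiveˡ; ,-injectiveʳ)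
open import Data.Product.Function.NonDependent.Propositional using (_×-↔_)
open import Data.Sum using (_⊎_; inj₁; inj₂)
open import Function using (_∘_; _↔_; Injection; Injective)
open import Function.Properties.Inverse using (↔-refl; ↔-trans; ↔⇒↣)
open import Relation.Binary.Construct.Closure.ReflexiveTransitive using (ε; _◅_)
open import Relation.Binary.PropositionalEquality
open import Relation.Nullary using (yes; no; contradiction)
open import Relation.Nullary.Decidable using (decidable-stable)

-- Digit reversal is an involution.

funToFin-cong : ∀ {b n} {f g : Fin n → Fin b} → f ≗ g → funToFin f ≡ funToFin g
funToFin-cong {n = zero}  f≗g = refl
funToFin-cong {n = suc n} f≗g =
  cong₂ combine (f≗g zero) (funToFin-cong (f≗g ∘ Fin.suc))

π-involutive : ∀ b ℓ (x : Fin (b ^ ℓ)) →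
  DigitReversal.π b ℓ (DigitReversal.π b ℓ x) ≡ x
π-involutive b ℓ x = trans
  (funToFin-cong λ i → trans (Finₚ.finToFun-funToFin (digits ∘ opposite) (opposite i))
                             (cong digits (Finₚ.opposite-involutive i)))
  (Finₚ.funToFin-finToFin {ℓ} {b} x)
  where
  digits : Fin ℓ → Fin b
  digits = finToFun {b} {ℓ} x

π-injective : ∀ b ℓ → Injective _≡_ _≡_ (DigitReversal.π b ℓ)
π-injective b ℓ {x} {y} eq = begin
  x           ≡⟨ π-involutive b ℓ x ⟨
  π ℓ (π ℓ x) ≡⟨ cong (π ℓ) eq ⟩
  π ℓ (π ℓ y) ≡⟨ π-involutive b ℓ y ⟩
  y           ∎
  where
  open ≡-Reasoning
  open DigitReversal b

-- Block ownership.

-- The i-th coordinate of block q, when n coordinates are cut into p blocks of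
-- K consecutive ones.
block : ∀ {n p K} → n ≡ p ℕ.* K → Fin p → Fin K → Fin n
block n≡pK q i = cast (sym n≡pK) (combine q i)

block-injective : ∀ {n p K} (n≡pK : n ≡ p ℕ.* K) (q r : Fin p) (i j : Fin K) →
  block n≡pK q i ≡ block n≡pK r j → q ≡ r × i ≡ j
block-injective n≡pK q r i j eq =
  Finₚ.combine-injective q i r j (Finₚ.toℕ-injective (begin
    toℕ (combine q i)    ≡⟨ Finₚ.toℕ-cast (sym n≡pK) (combine q i) ⟨
    toℕ (block n≡pK q i) ≡⟨ cong toℕ eq ⟩
    toℕ (block n≡pK r j) ≡⟨ Finₚ.toℕ-cast (sym n≡pK) (combine r j) ⟩
    toℕ (combine r j)    ∎))
  where open ≡-Reasoning

blockOwner-block : ∀ {n p K} .{{_ : NonZero p}} (n≡pK : n ≡ p ℕ.* K) q i →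
  blockOwner p (block n≡pK q i) ≡ q
blockOwner-block {n} {p} {K} refl q i = Finₚ.toℕ-injective (begin
  toℕ (blockOwner p x)               ≡⟨ toℕ-blockOwner p x ⟩
  toℕ x ℕ.* p ℕ./ (p ℕ.* K)          ≡⟨ cong (ℕ._/ (p ℕ.* K)) (ℕₚ.*-comm (toℕ x) p) ⟩
  p ℕ.* toℕ x ℕ./ (p ℕ.* K)          ≡⟨ ℕ.m*n/m*o≡n/o p (toℕ x) K ⟩
  toℕ x ℕ./ K                        ≡⟨ cong (ℕ._/ K) toℕ-x ⟩
  (K ℕ.* toℕ q ℕ.+ toℕ i) ℕ./ K      ≡⟨ ℕ.+-distrib-/-∣ˡ (toℕ i) {K} (m∣m*n (toℕ q)) ⟩
  K ℕ.* toℕ q ℕ./ K ℕ.+ toℕ i ℕ./ K  ≡⟨ cong₂ ℕ._+_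
    (trans (cong (ℕ._/ K) (ℕₚ.*-comm K (toℕ q))) (ℕ.m*n/n≡m (toℕ q) K))
    (ℕ.m<n⇒m/n≡0 (Finₚ.toℕ<n i)) ⟩
  toℕ q ℕ.+ 0                        ≡⟨ ℕₚ.+-identityʳ (toℕ q) ⟩
  toℕ q                              ∎)
  where
  open ≡-Reasoning
  x : Fin n
  x = block refl q i
  instance
    K≢0 : NonZero K
    K≢0 = Finₚ.nonZeroIndex i
    pK≢0 : NonZero (p ℕ.* K)
    pK≢0 = ℕₚ.m*n≢0 p K
  toℕ-x : toℕ x ≡ K ℕ.* toℕ q ℕ.+ toℕ i
  toℕ-x = trans (Finₚ.toℕ-cast refl (combine q i)) (Finₚ.toℕ-combine q i)

-- Counting.

-- If n distinct labels f i all occur among the g-labels of the entries of xs,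
-- then xs has at least n entries.
labels≤length : ∀ {A B I : Set} {n} → Fin n ↔ I →
  (g : A → B) {f : I → B} → Injective _≡_ _≡_ f →
  (xs : List A) → (∀ i → Any (λ x → g x ≡ f i) xs) → n ≤ℕ length xs
labels≤length n↔I g {f} f-injective xs occurs =
  Finₚ.injective⇒≤ {f = λ k → index (occurs (to k))} λ {k} {l} eq →
    injective (f-injective (begin
      f (to k)                                  ≡⟨ Anyₚ.lookup-index (occurs (to k)) ⟨
      g (lookup xs (index (occurs (to k))))     ≡⟨ cong (g ∘ lookup xs) eq ⟩
      g (lookup xs (index (occurs (to l))))     ≡⟨ Anyₚ.lookup-index (occurs (to l)) ⟩
      f (to l)                                  ∎))
  where
  open ≡-Reasoning
  open Injection (↔⇒↣ n↔I) using (to; injective)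

-- Remote traffic of an execution.

module _ (b m₁ m₂ p : ℕ) .{{_ : NonZero p}} where
  open Redistribution b m₁ m₂ p

  -- A copy present at the end was there at the start or came in remotely: a local
  -- transmission only serves a processor that already holds the item.
  arrival : ∀ {S S′ x q} (e : Execution S S′) → q ∈ S′ x →
    q ∈ S x ⊎ Any (Delivers x q) (remoteTraffic e)
  arrival ε q∈ = inj₁ q∈
  arrival (step ◅ e) q∈ with arrival e q∈
  ... | inj₂ later = inj₂ (Anyₚ.++⁺ʳ _ later)
  ... | inj₁ q∈′ with origin step q∈′
  ...   | inj₁ q∈₀ = inj₁ q∈₀
  ...   | inj₂ now with find now
  ...     | τ , τ∈ , refl , refl with remote? τ
  ...       | yes remote = inj₂ (Anyₚ.++⁺ˡ (lose (∈-filter⁺ remote? τ∈ remote) (refl , refl)))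
  ...       | no local = inj₁ (subst (_∈ _)
                (decidable-stable (sender τ ≟ receiver τ) local)
                (All.lookup (held step) τ∈))

  displaced-delivered : ∀ {S} (e : Execution initial S) → Materialized S →
    ∀ {x} → owner₀ x ≢ owner₁ (target x) →
    Any (Delivers x (owner₁ (target x))) (remoteTraffic e)
  displaced-delivered e done {x} moved with arrival e (done x)
  ... | inj₁ stays     = contradiction (sym (x∈⁅y⁆⇒x≡y (owner₀ x) stays)) moved
  ... | inj₂ delivered = delivered

  recv≤maxLoad : ∀ {S S′} (e : Execution S S′) q → hʳᵉᶜᵛ e q ≤ℕ maxLoad e
  recv≤maxLoad e q = ℕₚ.≤-trans (ℕₚ.m≤n⊔m (hˢᵉⁿᵈ e q) (hʳᵉᶜᵛ e q))
    (All.lookup (Allₚ.map⁻ (xs≤max 0 _)) (∈-allFin q))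

-- Displaced items.

module _ (b m₁ m₂ p′ K₁ K₂ : ℕ)
  (N₁≡pK₁ : b ^ m₁ ≡ suc p′ ℕ.* K₁) (N₂≡pK₂ : b ^ m₂ ≡ suc p′ ℕ.* K₂) where
  open Redistribution b m₁ m₂ (suc p′)

  -- A name for a displaced item with a given target owner q: its source owner
  -- is punchIn q r, and i , j are its positions within its target and source
  -- blocks.
  Index : Set
  Index = Fin p′ × Fin K₁ × Fin K₂

  -- The item with target owner q named by an index.  The target column of (a , c)
  -- is π m₁ a, so taking π m₁ of a column of block q gives a suitable a.
  displaced : Fin (suc p′) × Index → Item
  displaced (q , r , i , j) = π m₁ (block N₁≡pK₁ q i) , block N₂≡pK₂ (punchIn q r) j

  displaced-injective : Injective _≡_ _≡_ displaced
  displaced-injective {q , r , i , j} {q′ , r′ , i′ , j′} eq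
    with refl , refl ← block-injective N₁≡pK₁ q q′ i i′ (π-injective b m₁ (,-injectiveˡ eq))
    with s≡s′ , refl ← block-injective N₂≡pK₂ (punchIn q r) (punchIn q r′) j j′ (,-injectiveʳ eq)
    with refl ← Finₚ.punchIn-injective q r r′ s≡s′ = refl

  owner₀-displaced : ∀ q r i j → owner₀ (displaced (q , r , i , j)) ≡ punchIn q r
  owner₀-displaced q r i j = blockOwner-block N₂≡pK₂ (punchIn q r) j

  owner₁-displaced : ∀ q ix → owner₁ (target (displaced (q , ix))) ≡ q
  owner₁-displaced q (r , i , j) = trans
    (cong (blockOwner (suc p′)) (π-involutive b m₁ (block N₁≡pK₁ q i)))
    (blockOwner-block N₁≡pK₁ q i)

  module _ {S : Storage} (e : Execution initial S) (done : Materialized S) where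

    delivered : ∀ q ix → Any (Delivers (displaced (q , ix)) q) (remoteTraffic e)
    delivered q ix@(r , i , j) =
      subst (λ s → Any (Delivers (displaced (q , ix)) s) (remoteTraffic e))
        (owner₁-displaced q ix)
        (displaced-delivered b m₁ m₂ (suc p′) e done λ eq → Finₚ.punchInᵢ≢i q r
          (trans (sym (owner₀-displaced q r i j)) (trans eq (owner₁-displaced q ix))))

    Index↔ : Fin (p′ ℕ.* (K₁ ℕ.* K₂)) ↔ Index
    Index↔ = ↔-trans Finₚ.*↔× (↔-refl ×-↔ Finₚ.*↔×)

    volume-bound : suc p′ ℕ.* (p′ ℕ.* (K₁ ℕ.* K₂)) ≤ℕ μ e
    volume-bound = labels≤length (↔-trans Finₚ.*↔× (↔-refl ×-↔ Index↔))
      item displaced-injective (remoteTraffic e)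
      λ (q , ix) → Any.map proj₁ (delivered q ix)

    recv-bound : ∀ q → p′ ℕ.* (K₁ ℕ.* K₂) ≤ℕ hʳᵉᶜᵛ e q
    recv-bound q = labels≤length Index↔
      item (,-injectiveʳ ∘ displaced-injective {q , _} {q , _}) _
      λ ix → let τ , τ∈ , item≡ , receiver≡ = find (delivered q ix)
             in lose (∈-filter⁺ (λ τ → receiver τ ≟ q) τ∈ receiver≡) item≡

-- Rational form of the bounds.

-- With p = suc p′, the inequality x ≥ (N / d) (1 - 1 / p) multiplied by d p.
clear-denominators : ∀ N d x p′ .{{_ : NonZero d}} → N ℕ.* p′ ≤ℕ x ℕ.* (d ℕ.* suc p′) →
  + x / 1 ≥ (+ N / d) * (1ℚ - + 1 / suc p′)
clear-denominators N d@(suc d-1) x p′ h = ℚₚ.toℚᵘ-cancel-≤ (begin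
  toℚᵘ (y * (1ℚ - z))                        ≃⟨ ℚₚ.toℚᵘ-homo-* y (1ℚ - z) ⟩
  toℚᵘ y ℚᵘ.* toℚᵘ (1ℚ - z)                  ≃⟨ ℚᵘₚ.*-cong (ℚₚ.toℚᵘ-fromℚᵘ (mkℚᵘ (+ N) d-1)) one-z ⟩
  mkℚᵘ (+ N) d-1 ℚᵘ.* (1ℚᵘ ℚᵘ.- mkℚᵘ (+ 1) p′) ≤⟨ *≤* core ⟩
  mkℚᵘ (+ x) 0                               ≃⟨ ℚₚ.toℚᵘ-fromℚᵘ (mkℚᵘ (+ x) 0) ⟨
  toℚᵘ (+ x / 1)                             ∎)
  where
  open ℚᵘₚ.≤-Reasoning
  y = + N / d
  z = + 1 / suc p′
  one-z : toℚᵘ (1ℚ - z) ℚᵘ.≃ 1ℚᵘ ℚᵘ.- mkℚᵘ (+ 1) p′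
  one-z = ℚᵘₚ.≃-trans (ℚₚ.toℚᵘ-homo-+ 1ℚ (- z)) (ℚᵘₚ.+-congʳ 1ℚᵘ
    (ℚᵘₚ.≃-trans (ℚₚ.toℚᵘ-homo‿- z) (ℚᵘₚ.-‿cong (ℚₚ.toℚᵘ-fromℚᵘ (mkℚᵘ (+ 1) p′)))))
  lhs : + N ℤ.* (+ 1 ℤ.* + suc p′ ℤ.+ ℤ.- + 1 ℤ.* + 1) ℤ.* + 1 ≡ + (N ℕ.* p′)
  lhs = trans (ring (+ N) (+ p′)) (sym (ℤₚ.pos-* N p′))
    where
    ring : ∀ n k → n ℤ.* (+ 1 ℤ.* (+ 1 ℤ.+ k) ℤ.+ ℤ.- + 1 ℤ.* + 1) ℤ.* + 1 ≡ n ℤ.* k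
    ring = ℤSolver.solve-∀
  rhs : + x ℤ.* + (d ℕ.* (1 ℕ.* suc p′)) ≡ + (x ℕ.* (d ℕ.* suc p′))
  rhs = trans (sym (ℤₚ.pos-* x _)) (cong (λ k → + (x ℕ.* (d ℕ.* k))) (ℕₚ.*-identityˡ (suc p′)))
  core : + N ℤ.* (+ 1 ℤ.* + suc p′ ℤ.+ ℤ.- + 1 ℤ.* + 1) ℤ.* + 1
           ℤ.≤ + x ℤ.* + (d ℕ.* (1 ℕ.* suc p′))
  core = subst₂ ℤ._≤_ (sym lhs) (sym rhs) (ℤ.+≤+ h)

proposition4 : (t m₁ m₂ p : ℕ) .{{_ : NonZero p}} →
    let b = 2 ^ t in
    let open Redistribution b m₁ m₂ p in
    2 ≤ℕ p → (∃[ k ] p ≡ b ^ k) → p ∣ N₁ → p ∣ N₂ →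
    ∀ {S} (e : Execution initial S) → Materialized S →
    (+ μ e / 1 ≥ (+ N / 1) * (1ℚ - + 1 / p))
    × (+ maxLoad e / 1 ≥ (+ N / p) * (1ℚ - + 1 / p))
proposition4 t m₁ m₂ p@(suc p′) _ _ (divides K₁ N₁≡K₁p) (divides K₂ N₂≡K₂p) e done =
  clear-denominators N 1 (μ e) p′ (begin
    N ℕ.* p′                                  ≡⟨ cong (ℕ._* p′) N≡ ⟩
    (p ℕ.* K₁) ℕ.* (p ℕ.* K₂) ℕ.* p′          ≡⟨ volume-ring p p′ K₁ K₂ ⟩
    p ℕ.* (p′ ℕ.* (K₁ ℕ.* K₂)) ℕ.* (1 ℕ.* p)  ≤⟨ ℕₚ.*-monoˡ-≤ (1 ℕ.* p)
      (volume-bound b m₁ m₂ p′ K₁ K₂ N₁≡pK₁ N₂≡pK₂ e done) ⟩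
    μ e ℕ.* (1 ℕ.* p)                         ∎) ,
  -- All processors satisfy the same receive bound; processor 0 is enough.
  clear-denominators N p (maxLoad e) p′ (begin
    N ℕ.* p′                                  ≡⟨ cong (ℕ._* p′) N≡ ⟩
    (p ℕ.* K₁) ℕ.* (p ℕ.* K₂) ℕ.* p′          ≡⟨ load-ring p p′ K₁ K₂ ⟩
    p′ ℕ.* (K₁ ℕ.* K₂) ℕ.* (p ℕ.* p)          ≤⟨ ℕₚ.*-monoˡ-≤ (p ℕ.* p)
      (ℕₚ.≤-trans (recv-bound b m₁ m₂ p′ K₁ K₂ N₁≡pK₁ N₂≡pK₂ e done zero)
                  (recv≤maxLoad b m₁ m₂ p e zero)) ⟩
    maxLoad e ℕ.* (p ℕ.* p)                   ∎)
  where
  b = 2 ^ t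
  open Redistribution b m₁ m₂ p using (N₁; N₂; N; μ; maxLoad)
  open ℕₚ.≤-Reasoning
  N₁≡pK₁ : N₁ ≡ p ℕ.* K₁
  N₁≡pK₁ = trans N₁≡K₁p (ℕₚ.*-comm K₁ p)
  N₂≡pK₂ : N₂ ≡ p ℕ.* K₂
  N₂≡pK₂ = trans N₂≡K₂p (ℕₚ.*-comm K₂ p)
  N≡ : N ≡ (p ℕ.* K₁) ℕ.* (p ℕ.* K₂)
  N≡ = cong₂ ℕ._*_ N₁≡pK₁ N₂≡pK₂
  volume-ring : ∀ p p′ K₁ K₂ → (p ℕ.* K₁) ℕ.* (p ℕ.* K₂) ℕ.* p′
    ≡ p ℕ.* (p′ ℕ.* (K₁ ℕ.* K₂)) ℕ.* (1 ℕ.* p)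
  volume-ring = ℕSolver.solve-∀
  load-ring : ∀ p p′ K₁ K₂ → (p ℕ.* K₁) ℕ.* (p ℕ.* K₂) ℕ.* p′
    ≡ p′ ℕ.* (K₁ ℕ.* K₂) ℕ.* (p ℕ.* p)
  load-ring = ℕSolver.solve-∀
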